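{- Let $C=(c_{ij})$ and $C'=(c'_{ij})$ be $n\times n$ matrices with row-sum vectors $(r_1,\ldots,r_n)^T$ and $(r'_1,\ldots,r'_n)^T$ respectively. Assume that (i) $c_{ij}\le c'_{ij}$ for all $1\le i\le n$, $1\le j\le n-1$, and $r_i\le r'_i$ for all $1\le i\le n$; (ii) $C'$ has a rooted eigenvector $v'=(v'_1,\ldots,v'_n)^T$ for $\lambda'$, for some $\lambda'\in\mathbb{R}$; (iii) $C$ has a nonnegative left eigenvector $v^T=(v_1,\ldots,v_n)$ for $\lambda\in\mathbb{R}$; (iv) $v^Tv'>0$. Then $\lambda\le\lambda'$. Moreover, $\lambda=\lambda'$ if and only if both of the following hold: (a) if $v'_n\ne 0$, then $r_i=r'_i$ for all $1\le i\le n$ with $v_i\ne 0$; (b) $c'_{ij}=c_{ij}$ for all $1\le i\le n$, $1\le j\le n-1$ with $v_i\ne 0$ and $v'_j>v'_n$.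
   Context: All matrices and vectors are real. The row-sum vector of $C=(c_{ij})$ is $(r_1,\ldots,r_n)^T$ with $r_i=\sum_{j=1}^n c_{ij}$. A column vector $v'=(v'_1,\ldots,v'_n)^T$ is called rooted if $v'_j\ge v'_n\ge 0$ for $1\le j\le n-1$. Eigenvectors are nonzero; "eigenvector" means right eigenvector ($C'v'=\lambda'v'$), and a left eigenvector $v^T$ of $C$ for $\lambda$ satisfies $v^TC=\lambda v^T$. Nonnegative means entrywise nonnegative. -}

module Defs where

open import Algebra.Bundles.Raw using (RawMonoid)
open import Algebra.Definitions.RawMonoid using (sum)
open import Data.Fin.Base using (Fin; inject₁)
open import Data.Nat.Base as ℕ using (ℕ; suc)
import Data.Nat.Properties as ℕₚ
open import Data.Product.Base using (∃-syntax; _×_; _,_)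
open import Data.Rational.Base as ℚ using (ℚ; 0ℚ; 1ℚ; ½; ∣_∣)
import Data.Rational.Properties as ℚₚ
open import Data.Rational.Solver using (module +-*-Solver)
open import Data.Vec.Functional using (Vector; last)
open import Level using (0ℓ)
open import Relation.Binary.PropositionalEquality
  using (_≡_; refl; sym; trans; cong; cong₂; subst)
open import Relation.Nullary.Negation.Core using (¬_)

------------------------------------------------------------------------
-- The real numbers: Cauchy sequences of rationals, with equality given by
-- the setoid relation _≃_ ("the difference tends to 0").

IsCauchy : (ℕ → ℚ) → Set
IsCauchy x = ∀ ε → 0ℚ ℚ.< ε →
  ∃[ N ] (∀ m n → N ℕ.≤ m → N ℕ.≤ n → ∣ x m ℚ.- x n ∣ ℚ.< ε)

record ℝ : Set where
  constructor mkℝ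
  field
    seq    : ℕ → ℚ
    cauchy : IsCauchy seq

open ℝ public

infix 4 _≃_ _≤_ _<_

_≃_ : ℝ → ℝ → Set
x ≃ y = ∀ ε → 0ℚ ℚ.< ε →
  ∃[ N ] (∀ n → N ℕ.≤ n → ∣ seq x n ℚ.- seq y n ∣ ℚ.< ε)

_≤_ : ℝ → ℝ → Set
x ≤ y = ∀ ε → 0ℚ ℚ.< ε →
  ∃[ N ] (∀ n → N ℕ.≤ n → seq x n ℚ.< seq y n ℚ.+ ε)

-- A rational gap eventually separates the sequences; eventual termwise _<_
-- alone would not respect _≃_.
_<_ : ℝ → ℝ → Set
x < y = ∃[ ε ] (0ℚ ℚ.< ε × ∃[ N ] (∀ n → N ℕ.≤ n → seq x n ℚ.+ ε ℚ.< seq y n))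

0<½* : ∀ {ε} → 0ℚ ℚ.< ε → 0ℚ ℚ.< ½ ℚ.* ε
0<½* {ε} 0<ε = subst (ℚ._< ½ ℚ.* ε) (ℚₚ.*-zeroʳ ½) (ℚₚ.*-monoʳ-<-pos ½ 0<ε)

½+½ : ∀ ε → ½ ℚ.* ε ℚ.+ ½ ℚ.* ε ≡ ε
½+½ ε = trans (sym (ℚₚ.*-distribʳ-+ ε ½ ½)) (ℚₚ.*-identityˡ ε)

scale : ∀ B ε → 0ℚ ℚ.< B → 0ℚ ℚ.< ε → ∃[ δ ] (0ℚ ℚ.< δ × B ℚ.* δ ≡ ε)
scale B ε 0<B 0<ε = δ , 0<δ , eq
  where
  instance
    B⁺ : ℚ.Positive B
    B⁺ = ℚ.positive 0<B
    B≠0 : ℚ.NonZero B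
    B≠0 = ℚₚ.pos⇒nonZero B
    B⁻¹⁺ : ℚ.Positive (ℚ.1/ B)
    B⁻¹⁺ = ℚₚ.1/pos⇒pos B
  δ : ℚ
  δ = ℚ.1/ B ℚ.* ε
  0<δ : 0ℚ ℚ.< δ
  0<δ = subst (ℚ._< δ) (ℚₚ.*-zeroʳ (ℚ.1/ B)) (ℚₚ.*-monoʳ-<-pos (ℚ.1/ B) 0<ε)
  eq : B ℚ.* δ ≡ ε
  eq = trans (sym (ℚₚ.*-assoc B (ℚ.1/ B) ε))
      (trans (cong (ℚ._* ε) (ℚₚ.*-inverseʳ B)) (ℚₚ.*-identityˡ ε))

bounded : ∀ {x} → IsCauchy x →
          ∃[ B ] (0ℚ ℚ.< B × ∃[ N ] (∀ n → N ℕ.≤ n → ∣ x n ∣ ℚ.≤ B))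
bounded {x} cx with cx 1ℚ (ℚₚ.positive⁻¹ 1ℚ)
... | N , p = 1ℚ ℚ.+ ∣ x N ∣ , 0<B , N , bound
  where
  0<B : 0ℚ ℚ.< 1ℚ ℚ.+ ∣ x N ∣
  0<B = ℚₚ.+-mono-<-≤ (ℚₚ.positive⁻¹ 1ℚ) (ℚₚ.0≤∣p∣ (x N))
  split : ∀ a b → a ≡ (a ℚ.- b) ℚ.+ b
  split = solve 2 (λ a b → a := (a :- b) :+ b) refl
    where open +-*-Solver
  bound : ∀ n → N ℕ.≤ n → ∣ x n ∣ ℚ.≤ 1ℚ ℚ.+ ∣ x N ∣
  bound n N≤n = begin
    ∣ x n ∣                        ≡⟨ cong ∣_∣ (split (x n) (x N)) ⟩
    ∣ (x n ℚ.- x N) ℚ.+ x N ∣      ≤⟨ ℚₚ.∣p+q∣≤∣p∣+∣q∣ (x n ℚ.- x N) (x N) ⟩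
    ∣ x n ℚ.- x N ∣ ℚ.+ ∣ x N ∣    ≤⟨ ℚₚ.+-monoˡ-≤ ∣ x N ∣ (ℚₚ.<⇒≤ (p n N N≤n ℕₚ.≤-refl)) ⟩
    1ℚ ℚ.+ ∣ x N ∣                 ∎
    where open ℚₚ.≤-Reasoning

const-cauchy : ∀ q → IsCauchy (λ _ → q)
const-cauchy q ε 0<ε = 0 , λ _ _ _ _ →
  subst (ℚ._< ε) (sym (cong ∣_∣ (ℚₚ.+-inverseʳ q))) 0<ε

+-cauchy : ∀ x y → IsCauchy x → IsCauchy y → IsCauchy (λ n → x n ℚ.+ y n)
+-cauchy x y cx cy ε 0<ε
  with cx (½ ℚ.* ε) (0<½* 0<ε) | cy (½ ℚ.* ε) (0<½* 0<ε)
... | N , p | M , q = N ℕ.⊔ M , λ m n N⊔M≤m N⊔M≤n →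
  let open ℚₚ.≤-Reasoning in begin-strict
    ∣ (x m ℚ.+ y m) ℚ.- (x n ℚ.+ y n) ∣
      ≡⟨ cong ∣_∣ (regroup (x m) (y m) (x n) (y n)) ⟩
    ∣ (x m ℚ.- x n) ℚ.+ (y m ℚ.- y n) ∣
      ≤⟨ ℚₚ.∣p+q∣≤∣p∣+∣q∣ (x m ℚ.- x n) (y m ℚ.- y n) ⟩
    ∣ x m ℚ.- x n ∣ ℚ.+ ∣ y m ℚ.- y n ∣
      <⟨ ℚₚ.+-mono-< (p m n (ℕₚ.m⊔n≤o⇒m≤o N M N⊔M≤m) (ℕₚ.m⊔n≤o⇒m≤o N M N⊔M≤n))
                     (q m n (ℕₚ.m⊔n≤o⇒n≤o N M N⊔M≤m) (ℕₚ.m⊔n≤o⇒n≤o N M N⊔M≤n)) ⟩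
    ½ ℚ.* ε ℚ.+ ½ ℚ.* ε
      ≡⟨ ½+½ ε ⟩
    ε ∎
  where
  regroup : ∀ a b c d → (a ℚ.+ b) ℚ.- (c ℚ.+ d) ≡ (a ℚ.- c) ℚ.+ (b ℚ.- d)
  regroup = solve 4 (λ a b c d → (a :+ b) :- (c :+ d) := (a :- c) :+ (b :- d)) refl
    where open +-*-Solver

*-small : ∀ {B δ a b} → 0ℚ ℚ.< B → ∣ a ∣ ℚ.≤ B → ∣ b ∣ ℚ.< δ →
          ∣ a ℚ.* b ∣ ℚ.< B ℚ.* δ
*-small {B} {δ} {a} {b} 0<B a≤B b<δ = begin-strict
  ∣ a ℚ.* b ∣        ≡⟨ ℚₚ.∣p*q∣≡∣p∣*∣q∣ a b ⟩
  ∣ a ∣ ℚ.* ∣ b ∣    ≤⟨ ℚₚ.*-monoʳ-≤-nonNeg ∣ b ∣ {{ℚₚ.∣-∣-nonNeg b}} a≤B ⟩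
  B ℚ.* ∣ b ∣        <⟨ ℚₚ.*-monoʳ-<-pos B {{ℚ.positive 0<B}} b<δ ⟩
  B ℚ.* δ            ∎
  where open ℚₚ.≤-Reasoning

*-cauchy : ∀ x y → IsCauchy x → IsCauchy y → IsCauchy (λ n → x n ℚ.* y n)
*-cauchy x y cx cy ε 0<ε =
  let A , 0<A , N₁ , bx = bounded cx
      B , 0<B , N₂ , by = bounded cy
      α , 0<α , Aα≡     = scale A (½ ℚ.* ε) 0<A (0<½* 0<ε)
      β , 0<β , Bβ≡     = scale B (½ ℚ.* ε) 0<B (0<½* 0<ε)
      N₃ , py           = cy α 0<α
      N₄ , px           = cx β 0<β
      N                 = (N₁ ℕ.⊔ N₂) ℕ.⊔ (N₃ ℕ.⊔ N₄)
      ₁₂ : ∀ {k} → N ℕ.≤ k → N₁ ℕ.⊔ N₂ ℕ.≤ k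
      ₁₂ = ℕₚ.m⊔n≤o⇒m≤o (N₁ ℕ.⊔ N₂) (N₃ ℕ.⊔ N₄)
      ₃₄ : ∀ {k} → N ℕ.≤ k → N₃ ℕ.⊔ N₄ ℕ.≤ k
      ₃₄ = ℕₚ.m⊔n≤o⇒n≤o (N₁ ℕ.⊔ N₂) (N₃ ℕ.⊔ N₄)
      open ℚₚ.≤-Reasoning
  in N , λ m n N≤m N≤n → begin-strict
    ∣ x m ℚ.* y m ℚ.- x n ℚ.* y n ∣
      ≡⟨ cong ∣_∣ (regroup (x m) (y m) (x n) (y n)) ⟩
    ∣ x m ℚ.* (y m ℚ.- y n) ℚ.+ y n ℚ.* (x m ℚ.- x n) ∣
      ≤⟨ ℚₚ.∣p+q∣≤∣p∣+∣q∣ (x m ℚ.* (y m ℚ.- y n)) (y n ℚ.* (x m ℚ.- x n)) ⟩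
    ∣ x m ℚ.* (y m ℚ.- y n) ∣ ℚ.+ ∣ y n ℚ.* (x m ℚ.- x n) ∣
      <⟨ ℚₚ.+-mono-<
           (*-small {a = x m} {b = y m ℚ.- y n} 0<A
             (bx m (ℕₚ.m⊔n≤o⇒m≤o N₁ N₂ (₁₂ N≤m)))
             (py m n (ℕₚ.m⊔n≤o⇒m≤o N₃ N₄ (₃₄ N≤m)) (ℕₚ.m⊔n≤o⇒m≤o N₃ N₄ (₃₄ N≤n))))
           (*-small {a = y n} {b = x m ℚ.- x n} 0<B
             (by n (ℕₚ.m⊔n≤o⇒n≤o N₁ N₂ (₁₂ N≤n)))
             (px m n (ℕₚ.m⊔n≤o⇒n≤o N₃ N₄ (₃₄ N≤m)) (ℕₚ.m⊔n≤o⇒n≤o N₃ N₄ (₃₄ N≤n)))) ⟩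
    A ℚ.* α ℚ.+ B ℚ.* β
      ≡⟨ cong₂ ℚ._+_ Aα≡ Bβ≡ ⟩
    ½ ℚ.* ε ℚ.+ ½ ℚ.* ε
      ≡⟨ ½+½ ε ⟩
    ε ∎
  where
  regroup : ∀ a b c d →
    a ℚ.* b ℚ.- c ℚ.* d ≡ a ℚ.* (b ℚ.- d) ℚ.+ d ℚ.* (a ℚ.- c)
  regroup = solve 4 (λ a b c d →
    a :* b :- c :* d := a :* (b :- d) :+ d :* (a :- c)) refl
    where open +-*-Solver

infixl 6 _+_
infixl 7 _*_

0ℝ : ℝ
0ℝ = mkℝ (λ _ → 0ℚ) (const-cauchy 0ℚ)

_+_ : ℝ → ℝ → ℝ
x + y = mkℝ (λ n → seq x n ℚ.+ seq y n) (+-cauchy (seq x) (seq y) (cauchy x) (cauchy y))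

_*_ : ℝ → ℝ → ℝ
x * y = mkℝ (λ n → seq x n ℚ.* seq y n) (*-cauchy (seq x) (seq y) (cauchy x) (cauchy y))

+-0-rawMonoid : RawMonoid 0ℓ 0ℓ
+-0-rawMonoid = record { Carrier = ℝ ; _≈_ = _≃_ ; _∙_ = _+_ ; ε = 0ℝ }

------------------------------------------------------------------------
-- Vectors and matrices

Matrix : ℕ → Set
Matrix n = Fin n → Fin n → ℝ

∑ : ∀ {n} → Vector ℝ n → ℝ
∑ = sum +-0-rawMonoid

rowSum : ∀ {n} → Matrix n → Vector ℝ n
rowSum C i = ∑ (λ j → C i j)

infix 7 _∙_

_∙_ : ∀ {n} → Vector ℝ n → Vector ℝ n → ℝ
u ∙ w = ∑ (λ i → u i * w i)

NonZero : ∀ {n} → Vector ℝ n → Set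
NonZero v = ¬ (∀ i → v i ≃ 0ℝ)

NonNegative : ∀ {n} → Vector ℝ n → Set
NonNegative v = ∀ i → 0ℝ ≤ v i

IsEigenvector : ∀ {n} → Matrix n → ℝ → Vector ℝ n → Set
IsEigenvector C μ v = NonZero v × (∀ i → ∑ (λ j → C i j * v j) ≃ μ * v i)

IsLeftEigenvector : ∀ {n} → Matrix n → ℝ → Vector ℝ n → Set
IsLeftEigenvector C μ v = NonZero v × (∀ j → ∑ (λ i → v i * C i j) ≃ μ * v j)

-- For vectors and matrices of size suc m, the index n is the last one
-- (fromℕ m, the entry taken by last), and inject₁ j, for j : Fin m, runs
-- over the indices 1, …, n - 1.
Rooted : ∀ {m} → Vector ℝ (suc m) → Set
Rooted v = (∀ j → last v ≤ v (inject₁ j)) × 0ℝ ≤ last v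

{-# OPTIONS --safe #-}

-- Write ℓ = v'ₙ and d = v' - ℓ.  Evaluating vᵀ(C' - C)v' in two ways gives
--   (μ' - μ)(vᵀv') = ∑ᵢ vᵢ (∑ⱼ (c'ᵢⱼ - cᵢⱼ) dⱼ + (r'ᵢ - rᵢ) ℓ),
-- where every factor on the right is nonnegative, since dₙ = 0.  As vᵀv' > 0, this yields
-- μ ≤ μ', and equality holds iff every summand vanishes.
-- Constructively, a product of nonnegative reals need not have a factor decidably equal to
-- zero, but equality of reals is stable under double negation, so "xy = 0" is still
-- equivalent to "x ≠ 0 implies y = 0" and to "y > 0 implies x = 0".

module Submission where

open import Algebra.Bundles using (CommutativeRing)
import Algebra.Properties.CommutativeSemigroup as CommutativeSemigroupProperties
import Algebra.Properties.Ring as RingProperties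
import Algebra.Properties.Semiring.Sum as SemiringSum
open import Algebra.Structures using (IsAbelianGroup; IsMonoid; IsRing; IsSemigroup)
open import Data.Empty using (⊥)
open import Data.Fin.Base using (Fin; zero; suc; inject₁)
open import Data.Fin.Relation.Unary.Top using (view; ‵fromℕ; ‵inject₁)
open import Data.Nat.Base as ℕ using (ℕ; suc)
import Data.Nat.Properties as ℕₚ
open import Data.Product.Base using (∃-syntax; _×_; _,_; proj₁; proj₂)
open import Data.Rational.Base as ℚ using (0ℚ; 1ℚ; ½; ∣_∣)
import Data.Rational.Properties as ℚₚ
open import Data.Rational.Solver using (module +-*-Solver)
open import Data.Sum.Base using (inj₁; inj₂)
open import Data.Vec.Functional using (Vector; foldr; last)
open import Function.Base using (_∘_)
open import Function.Bundles using (_⇔_; mk⇔; module Equivalence)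
open import Level using (0ℓ)
import Relation.Binary.Reasoning.Setoid as SetoidReasoning
open import Relation.Binary.Structures using (IsEquivalence)
open import Relation.Nullary.Decidable.Core using (yes; no)
open import Relation.Nullary.Negation.Core using (¬_; contradiction)

open Equivalence using (to; from)

-- Ordered commutative rings

-- The order is given by sign predicates, with axioms that hold constructively for Cauchy reals:
-- neither decidable signs nor inverses are assumed. `0≮⇒0≤-` is the axiom that turns a refutation
-- into positive information, so case distinctions can be made while deriving a contradiction.
record OrderedCommutativeRing : Set₁ where
  infix 4 0≤_ 0<_
  field
    commutativeRing : CommutativeRing 0ℓ 0ℓ

  open CommutativeRing commutativeRing public hiding (zero)

  field
    0≤_ 0<_    : Carrier → Set
    0≤-resp-≈  : ∀ {x y} → x ≈ y → 0≤ x → 0≤ y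
    0≤-0#      : 0≤ 0#
    0≤-+       : ∀ {x y} → 0≤ x → 0≤ y → 0≤ x + y
    0≤-antisym : ∀ {x} → 0≤ x → 0≤ - x → x ≈ 0#
    0<⇒0≤      : ∀ {x} → 0< x → 0≤ x
    0<⇒0≰-     : ∀ {x} → 0< x → ¬ 0≤ - x
    0≮⇒0≤-     : ∀ {x} → ¬ 0< x → 0≤ - x
    0<-*       : ∀ {x y} → 0< x → 0< y → 0< x * y

module OrderedRingProperties (K : OrderedCommutativeRing) where
  open OrderedCommutativeRing K
  open RingProperties ring public
  open SemiringSum semiring public
  open CommutativeSemigroupProperties *-commutativeSemigroup public using (x∙yz≈y∙xz)
  open SetoidReasoning setoid

  0<⇒≉0 : ∀ {x} → 0< x → ¬ x ≈ 0#
  0<⇒≉0 0<x x≈0 = 0<⇒0≰- 0<x (0≤-resp-≈ (sym (trans (-‿cong x≈0) -0#≈0#)) 0≤-0#)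

  0≮-⇒0≤ : ∀ {x} → ¬ 0< - x → 0≤ x
  0≮-⇒0≤ {x} = 0≤-resp-≈ (-‿involutive x) ∘ 0≮⇒0≤-

  0≤∧0≮⇒≈0 : ∀ {x} → 0≤ x → ¬ 0< x → x ≈ 0#
  0≤∧0≮⇒≈0 0≤x 0≮x = 0≤-antisym 0≤x (0≮⇒0≤- 0≮x)

  -- By antisymmetry it suffices to refute `0< - x` and `0< x`, and a refutation may consume the
  -- doubly negated hypothesis.
  ≈0-stable : ∀ {x} → ¬ ¬ x ≈ 0# → x ≈ 0#
  ≈0-stable ¬¬x≈0 = 0≤-antisym
    (0≮-⇒0≤ λ 0<-x → ¬¬x≈0 λ x≈0 → 0<⇒≉0 0<-x (trans (-‿cong x≈0) -0#≈0#))
    (0≮⇒0≤- λ 0<x → ¬¬x≈0 (0<⇒≉0 0<x))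

  x≈0⇒x*y≈0 : ∀ {x} y → x ≈ 0# → x * y ≈ 0#
  x≈0⇒x*y≈0 y x≈0 = trans (*-congʳ x≈0) (zeroˡ y)

  y≈0⇒x*y≈0 : ∀ x {y} → y ≈ 0# → x * y ≈ 0#
  y≈0⇒x*y≈0 x y≈0 = trans (*-congˡ y≈0) (zeroʳ x)

  -- Assume `- (x * y)` is positive. Then the product is nonzero, so neither factor can be zero; as
  -- both are nonnegative, each may be taken positive on the way to a contradiction, and then `0<-*`
  -- gives the product the wrong sign.
  0≤-* : ∀ {x y} → 0≤ x → 0≤ y → 0≤ x * y
  0≤-* {x} {y} 0≤x 0≤y = 0≮-⇒0≤ λ 0<-xy →
    let xy≉0 : ¬ x * y ≈ 0#
        xy≉0 xy≈0 = 0<⇒≉0 0<-xy (trans (-‿cong xy≈0) -0#≈0#)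
        0≰xy : ¬ 0≤ x * y
        0≰xy = 0<⇒0≰- 0<-xy ∘ 0≤-resp-≈ (sym (-‿involutive (x * y)))
    in xy≉0 (x≈0⇒x*y≈0 y (0≤∧0≮⇒≈0 0≤x λ 0<x →
       xy≉0 (y≈0⇒x*y≈0 x (0≤∧0≮⇒≈0 0≤y λ 0<y →
       0≰xy (0<⇒0≤ (0<-* 0<x 0<y))))))

  -- Replaces division by `y`: were `- x` positive, so would be `- x * y`.
  0≤-*-cancelʳ : ∀ {x y} → 0< y → 0≤ x * y → 0≤ x
  0≤-*-cancelʳ {x} {y} 0<y 0≤xy = 0≮-⇒0≤ λ 0<-x →
    0<⇒0≰- (0<-* 0<-x 0<y) (0≤-resp-≈ xy≈--xy 0≤xy)
    where
    xy≈--xy : x * y ≈ - (- x * y)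
    xy≈--xy = trans (sym (-‿involutive (x * y))) (-‿cong (-‿distribˡ-* x y))

  x*y≈0⇒x≈0 : ∀ {x y} → 0< y → x * y ≈ 0# → x ≈ 0#
  x*y≈0⇒x≈0 {x} {y} 0<y xy≈0 = 0≤-antisym
    (0≤-*-cancelʳ 0<y (0≤-resp-≈ (sym xy≈0) 0≤-0#))
    (0≤-*-cancelʳ 0<y (0≤-resp-≈ (sym -xy≈0) 0≤-0#))
    where
    -xy≈0 : - x * y ≈ 0#
    -xy≈0 = trans (sym (-‿distribˡ-* x y)) (trans (-‿cong xy≈0) -0#≈0#)

  -- Backwards, a nonzero product would force `x` to be nonzero, hence `y` to vanish, hence the
  -- product to vanish; stability of `_≈_` to zero removes the double negation. The sign of `x` is
  -- left free.
  x*y≈0⇔[x≉0⇒y≈0] : ∀ {x y} → 0≤ y → x * y ≈ 0# ⇔ (¬ x ≈ 0# → y ≈ 0#)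
  x*y≈0⇔[x≉0⇒y≈0] {x} {y} 0≤y = mk⇔
    (λ xy≈0 x≉0 → 0≤∧0≮⇒≈0 0≤y λ 0<y → x≉0 (x*y≈0⇒x≈0 0<y xy≈0))
    (λ x≉0⇒y≈0 → ≈0-stable λ xy≉0 →
      xy≉0 (y≈0⇒x*y≈0 x (x≉0⇒y≈0 (xy≉0 ∘ x≈0⇒x*y≈0 y))))

  x*y≈0⇔[0<y⇒x≈0] : ∀ {x y} → 0≤ y → x * y ≈ 0# ⇔ (0< y → x ≈ 0#)
  x*y≈0⇔[0<y⇒x≈0] {x} {y} 0≤y = mk⇔
    (λ xy≈0 0<y → x*y≈0⇒x≈0 0<y xy≈0)
    (λ 0<y⇒x≈0 → ≈0-stable λ xy≉0 →
      xy≉0 (y≈0⇒x*y≈0 x (0≤∧0≮⇒≈0 0≤y (xy≉0 ∘ x≈0⇒x*y≈0 y ∘ 0<y⇒x≈0))))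

  -- If the sum vanishes, each term is the negative of the other, so both it and its negative are
  -- nonnegative.
  x+y≈0⇔x≈0×y≈0 : ∀ {x y} → 0≤ x → 0≤ y → x + y ≈ 0# ⇔ (x ≈ 0# × y ≈ 0#)
  x+y≈0⇔x≈0×y≈0 {x} {y} 0≤x 0≤y = mk⇔
    (λ x+y≈0 →
      0≤-antisym 0≤x (0≤-resp-≈ (+-inverseʳ-unique x y x+y≈0) 0≤y) ,
      0≤-antisym 0≤y (0≤-resp-≈ (+-inverseˡ-unique x y x+y≈0) 0≤x))
    (λ (x≈0 , y≈0) → trans (+-cong x≈0 y≈0) (+-identityˡ 0#))

  0≤-sum : ∀ {n} {f : Vector Carrier n} → (∀ i → 0≤ f i) → 0≤ sum f
  0≤-sum {ℕ.zero}  0≤f = 0≤-0#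
  0≤-sum {ℕ.suc n} 0≤f = 0≤-+ (0≤f zero) (0≤-sum (0≤f ∘ suc))

  sum≈0⇔≈0 : ∀ {n} {f : Vector Carrier n} → (∀ i → 0≤ f i) → sum f ≈ 0# ⇔ (∀ i → f i ≈ 0#)
  sum≈0⇔≈0 {n} 0≤f = mk⇔ (sum≈0⇒≈0 0≤f)
    (λ f≈0 → trans (sum-cong-≋ f≈0) (sum-replicate-zero n))
    where
    sum≈0⇒≈0 : ∀ {n} {f : Vector Carrier n} → (∀ i → 0≤ f i) → sum f ≈ 0# → ∀ i → f i ≈ 0#
    sum≈0⇒≈0 {suc _} 0≤f sum≈0 i
      with to (x+y≈0⇔x≈0×y≈0 (0≤f zero) (0≤-sum (0≤f ∘ suc))) sum≈0 | i
    ... | f₀≈0 , _         | zero  = f₀≈0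
    ... | _    , sum-tail≈0 | suc j = sum≈0⇒≈0 (0≤f ∘ suc) sum-tail≈0 j

  sum-distrib-- : ∀ {n} (f g : Vector Carrier n) → sum (λ i → f i - g i) ≈ sum f - sum g
  sum-distrib-- f g = x≈z//y _ _ _ (begin
    sum (λ i → f i - g i) + sum g      ≈⟨ ∑-distrib-+ (λ i → f i - g i) g ⟨
    sum (λ i → f i - g i + g i)        ≈⟨ sum-cong-≋ (λ i → //-rightDividesˡ (g i) (f i)) ⟩
    sum f                              ∎)

-- Comparison of eigenvalues over an ordered commutative ring

module EigenvalueComparison (K : OrderedCommutativeRing) where
  open OrderedCommutativeRing K
  open OrderedRingProperties K
  open SetoidReasoning setoid

  module _ {m : ℕ} (C C' : Fin (suc m) → Fin (suc m) → Carrier)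
           (v v' : Vector Carrier (suc m)) (μ μ' : Carrier) where

    ℓ p : Carrier
    ℓ = last v'
    p = sum (λ i → v i * v' i)

    d r r' S : Vector Carrier (suc m)
    d j  = v' j - ℓ
    r i  = sum (C i)
    r' i = sum (C' i)
    S i  = sum (λ j → (C' i j - C i j) * d j) + (r' i - r i) * ℓ

    -- Substitute v' = d + ℓ in the part (C' - C) v' of C' v'.
    row-identity : ∀ i → sum (λ j → C' i j * v' j) ≈ S i + sum (λ j → C i j * v' j)
    row-identity i = begin
      sum (λ j → C' i j * v' j)
        ≈⟨ sum-cong-≋ entry ⟩
      sum (λ j → (D j * d j + D j * ℓ) + C i j * v' j)
        ≈⟨ ∑-distrib-+ (λ j → D j * d j + D j * ℓ) (λ j → C i j * v' j) ⟩
      sum (λ j → D j * d j + D j * ℓ) + sum (λ j → C i j * v' j)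
        ≈⟨ +-congʳ (∑-distrib-+ (λ j → D j * d j) (λ j → D j * ℓ)) ⟩
      (sum (λ j → D j * d j) + sum (λ j → D j * ℓ)) + sum (λ j → C i j * v' j)
        ≈⟨ +-congʳ (+-congˡ (*-distribʳ-sum ℓ D)) ⟨
      (sum (λ j → D j * d j) + sum D * ℓ) + sum (λ j → C i j * v' j)
        ≈⟨ +-congʳ (+-congˡ (*-congʳ (sum-distrib-- (C' i) (C i)))) ⟩
      S i + sum (λ j → C i j * v' j)
        ∎
      where
      D : Vector Carrier (suc m)
      D j = C' i j - C i j
      entry : ∀ j → C' i j * v' j ≈ (D j * d j + D j * ℓ) + C i j * v' j
      entry j = begin
        C' i j * v' j                            ≈⟨ *-congʳ (//-rightDividesˡ (C i j) (C' i j)) ⟨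
        (D j + C i j) * v' j                     ≈⟨ distribʳ (v' j) (D j) (C i j) ⟩
        D j * v' j + C i j * v' j                ≈⟨ +-congʳ (*-congˡ (//-rightDividesˡ ℓ (v' j))) ⟨
        D j * (d j + ℓ) + C i j * v' j           ≈⟨ +-congʳ (distribˡ (D j) (d j) ℓ) ⟩
        (D j * d j + D j * ℓ) + C i j * v' j     ∎

    module _ (C'v'≈μ'v' : ∀ i → sum (λ j → C' i j * v' j) ≈ μ' * v' i)
             (vC≈μv : ∀ j → sum (λ i → v i * C i j) ≈ μ * v j) where

      vC'v'≈μ'p : sum (λ i → v i * sum (λ j → C' i j * v' j)) ≈ μ' * p
      vC'v'≈μ'p = begin
        sum (λ i → v i * sum (λ j → C' i j * v' j))    ≈⟨ sum-cong-≋ (λ i → *-congˡ {v i} (C'v'≈μ'v' i)) ⟩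
        sum (λ i → v i * (μ' * v' i))                  ≈⟨ sum-cong-≋ (λ i → x∙yz≈y∙xz (v i) μ' (v' i)) ⟩
        sum (λ i → μ' * (v i * v' i))                  ≈⟨ *-distribˡ-sum μ' (λ i → v i * v' i) ⟨
        μ' * p                                         ∎

      -- The left eigenvector equation needs `v` next to `C`, so the order of summation is exchanged
      -- first.
      vCv'≈μp : sum (λ i → v i * sum (λ j → C i j * v' j)) ≈ μ * p
      vCv'≈μp = begin
        sum (λ i → v i * sum (λ j → C i j * v' j))      ≈⟨ sum-cong-≋ (λ i → *-distribˡ-sum (v i) (λ j → C i j * v' j)) ⟩
        sum (λ i → sum (λ j → v i * (C i j * v' j)))    ≈⟨ ∑-comm (λ i j → v i * (C i j * v' j)) ⟩
        sum (λ j → sum (λ i → v i * (C i j * v' j)))    ≈⟨ sum-cong-≋ (λ j → sum-cong-≋ λ i → *-assoc (v i) (C i j) (v' j)) ⟨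
        sum (λ j → sum (λ i → v i * C i j * v' j))      ≈⟨ sum-cong-≋ (λ j → *-distribʳ-sum (v' j) (λ i → v i * C i j)) ⟨
        sum (λ j → sum (λ i → v i * C i j) * v' j)      ≈⟨ sum-cong-≋ (λ j → trans (*-congʳ (vC≈μv j)) (*-assoc μ (v j) (v' j))) ⟩
        sum (λ j → μ * (v j * v' j))                    ≈⟨ *-distribˡ-sum μ (λ j → v j * v' j) ⟨
        μ * p                                           ∎

      -- `row-identity` is weighted by `v i` and summed over the rows; the two evaluations above
      -- then identify the sums with `μ' * p` and `μ * p`.
      eigenvalue-gap : (μ' - μ) * p ≈ sum (λ i → v i * S i)
      eigenvalue-gap = begin
        (μ' - μ) * p             ≈⟨ [y-z]x≈yx-zx p μ' μ ⟩
        μ' * p - μ * p           ≈⟨ x≈z//y (sum (λ i → v i * S i)) (μ * p) (μ' * p) gap ⟨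
        sum (λ i → v i * S i)    ∎
        where
        A : Vector Carrier (suc m)
        A i = sum (λ j → C i j * v' j)
        gap : sum (λ i → v i * S i) + μ * p ≈ μ' * p
        gap = begin
          sum (λ i → v i * S i) + μ * p                        ≈⟨ +-congˡ vCv'≈μp ⟨
          sum (λ i → v i * S i) + sum (λ i → v i * A i)        ≈⟨ ∑-distrib-+ (λ i → v i * S i) (λ i → v i * A i) ⟨
          sum (λ i → v i * S i + v i * A i)                    ≈⟨ sum-cong-≋ (λ i → distribˡ (v i) (S i) (A i)) ⟨
          sum (λ i → v i * (S i + A i))                        ≈⟨ sum-cong-≋ (λ i → *-congˡ {v i} (row-identity i)) ⟨
          sum (λ i → v i * sum (λ j → C' i j * v' j))          ≈⟨ vC'v'≈μ'p ⟩
          μ' * p                                               ∎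

      -- Sign conditions and the equality case

      module _ (C≤C' : ∀ i j → 0≤ C' i (inject₁ j) - C i (inject₁ j))
               (r≤r' : ∀ i → 0≤ r' i - r i)
               (ℓ≤v' : ∀ j → 0≤ v' (inject₁ j) - ℓ) (0≤ℓ : 0≤ ℓ)
               (0≤v : ∀ i → 0≤ v i) (0<p : 0< p) where

        d-last≈0 : last d ≈ 0#
        d-last≈0 = -‿inverseʳ ℓ

        0≤d : ∀ j → 0≤ d j
        0≤d j with view j
        ... | ‵fromℕ     = 0≤-resp-≈ (sym d-last≈0) 0≤-0#
        ... | ‵inject₁ k = ℓ≤v' k

        -- In the last column the difference of the entries may have either sign, but it is
        -- multiplied by `last d`, which is zero.
        0≤Dd : ∀ i j → 0≤ (C' i j - C i j) * d j
        0≤Dd i j with view j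
        ... | ‵fromℕ     = 0≤-resp-≈ (sym (y≈0⇒x*y≈0 _ d-last≈0)) 0≤-0#
        ... | ‵inject₁ k = 0≤-* (C≤C' i k) (ℓ≤v' k)

        0≤Rℓ : ∀ i → 0≤ (r' i - r i) * ℓ
        0≤Rℓ i = 0≤-* (r≤r' i) 0≤ℓ

        0≤S : ∀ i → 0≤ S i
        0≤S i = 0≤-+ (0≤-sum (0≤Dd i)) (0≤Rℓ i)

        0≤vS : ∀ i → 0≤ v i * S i
        0≤vS i = 0≤-* (0≤v i) (0≤S i)

        0≤μ'-μ : 0≤ μ' - μ
        0≤μ'-μ = 0≤-*-cancelʳ 0<p (0≤-resp-≈ (sym eigenvalue-gap) (0≤-sum 0≤vS))

        -- As `p` is positive, the eigenvalues agree exactly when the sum in `eigenvalue-gap`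
        -- vanishes. Its terms are nonnegative, so this happens term by term.
        μ≈μ'⇔S≈0 : μ ≈ μ' ⇔ (∀ i → ¬ v i ≈ 0# → S i ≈ 0#)
        μ≈μ'⇔S≈0 = mk⇔
          (λ μ≈μ' i → to (x*y≈0⇔[x≉0⇒y≈0] (0≤S i)) (to (sum≈0⇔≈0 0≤vS)
            (trans (sym eigenvalue-gap) (x≈0⇒x*y≈0 p (x≈y⇒x∙y⁻¹≈ε (sym μ≈μ')))) i))
          (λ S≈0 → sym (x∙y⁻¹≈ε⇒x≈y μ' μ (x*y≈0⇒x≈0 0<p (trans eigenvalue-gap
            (from (sum≈0⇔≈0 0≤vS) λ i → from (x*y≈0⇔[x≉0⇒y≈0] (0≤S i)) (S≈0 i))))))

        Dd≈0⇔C'≈C : ∀ i → (∀ j → (C' i j - C i j) * d j ≈ 0#) ⇔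
                           (∀ j → 0< d (inject₁ j) → C' i (inject₁ j) ≈ C i (inject₁ j))
        Dd≈0⇔C'≈C i = mk⇔
          (λ Dd≈0 j 0<d → x∙y⁻¹≈ε⇒x≈y _ _ (x*y≈0⇒x≈0 0<d (Dd≈0 (inject₁ j))))
          (λ C'≈C j → from (x*y≈0⇔[0<y⇒x≈0] (0≤d j)) (D≈0 C'≈C j))
          where
          D≈0 : (∀ j → 0< d (inject₁ j) → C' i (inject₁ j) ≈ C i (inject₁ j)) →
                ∀ j → 0< d j → C' i j - C i j ≈ 0#
          D≈0 C'≈C j 0<d with view j
          -- The right-hand condition says nothing about the last column; there `0< d j` is
          -- impossible.
          ... | ‵fromℕ     = contradiction d-last≈0 (0<⇒≉0 0<d)
          ... | ‵inject₁ k = x≈y⇒x∙y⁻¹≈ε (C'≈C k 0<d)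

        Rℓ≈0⇔r≈r' : ∀ i → (r' i - r i) * ℓ ≈ 0# ⇔ (¬ ℓ ≈ 0# → r i ≈ r' i)
        Rℓ≈0⇔r≈r' i = mk⇔
          (λ Rℓ≈0 ℓ≉0 → sym (x∙y⁻¹≈ε⇒x≈y _ _ (to ℓR⇔ (trans (*-comm _ _) Rℓ≈0) ℓ≉0)))
          (λ r≈r' → trans (*-comm _ _) (from ℓR⇔ (x≈y⇒x∙y⁻¹≈ε ∘ sym ∘ r≈r')))
          where
          -- The factors are swapped so that `ℓ` is the one tested against zero, which is the form
          -- of condition (a).
          ℓR⇔ = x*y≈0⇔[x≉0⇒y≈0] {ℓ} (r≤r' i)

        S≈0⇔r≈r'×C'≈C : ∀ i → S i ≈ 0# ⇔
          ((¬ ℓ ≈ 0# → r i ≈ r' i) ×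
           (∀ j → 0< d (inject₁ j) → C' i (inject₁ j) ≈ C i (inject₁ j)))
        S≈0⇔r≈r'×C'≈C i = mk⇔
          (λ S≈0 → let Dd≈0 , Rℓ≈0 = to S⇔ S≈0 in
            to (Rℓ≈0⇔r≈r' i) Rℓ≈0 , to (Dd≈0⇔C'≈C i) (to sum⇔ Dd≈0))
          (λ (r≈r' , C'≈C) → from S⇔
            (from sum⇔ (from (Dd≈0⇔C'≈C i) C'≈C) , from (Rℓ≈0⇔r≈r' i) r≈r'))
          where
          S⇔   = x+y≈0⇔x≈0×y≈0 (0≤-sum (0≤Dd i)) (0≤Rℓ i)
          sum⇔ = sum≈0⇔≈0 (0≤Dd i)

        eigenvalue-comparison :
          0≤ μ' - μ ×
          (μ ≈ μ' ⇔
            ((¬ ℓ ≈ 0# → ∀ i → ¬ v i ≈ 0# → r i ≈ r' i) ×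
             (∀ i j → ¬ v i ≈ 0# → 0< d (inject₁ j) → C' i (inject₁ j) ≈ C i (inject₁ j))))
        eigenvalue-comparison = 0≤μ'-μ , mk⇔
          (λ μ≈μ' → let S≈0 = to μ≈μ'⇔S≈0 μ≈μ' in
            (λ ℓ≉0 i v≉0 → proj₁ (to (S≈0⇔r≈r'×C'≈C i) (S≈0 i v≉0)) ℓ≉0) ,
            (λ i j v≉0 → proj₂ (to (S≈0⇔r≈r'×C'≈C i) (S≈0 i v≉0)) j))
          (λ (r≈r' , C'≈C) → from μ≈μ'⇔S≈0 λ i v≉0 → from (S≈0⇔r≈r'×C'≈C i)
            ((λ ℓ≉0 → r≈r' ℓ≉0 i v≉0) , (λ j → C'≈C i j v≉0)))

open import Relation.Binary.PropositionalEquality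
  using (_≡_; refl; sym; trans; cong; cong₂; subst; subst₂)
open import Defs
open +-*-Solver using (solve; _:=_; _:+_; _:*_; _:-_; :-_)

-- Rational inequalities

p≤∣p∣ : ∀ p → p ℚ.≤ ∣ p ∣
p≤∣p∣ p with ℚₚ.≤-total 0ℚ p
... | inj₁ 0≤p = ℚₚ.≤-reflexive (sym (ℚₚ.0≤p⇒∣p∣≡p 0≤p))
... | inj₂ p≤0 = ℚₚ.≤-trans p≤0 (ℚₚ.0≤∣p∣ p)

∣p-q∣≡∣q-p∣ : ∀ p q → ∣ p ℚ.- q ∣ ≡ ∣ q ℚ.- p ∣
∣p-q∣≡∣q-p∣ p q = trans
  (cong ∣_∣ (solve 2 (λ p q → p :- q := :- (q :- p)) refl p q)) (ℚₚ.∣-p∣≡∣p∣ (q ℚ.- p))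

∣p-q∣≡∣-p+q∣ : ∀ p q → ∣ p ℚ.- q ∣ ≡ ∣ ℚ.- p ℚ.- ℚ.- q ∣
∣p-q∣≡∣-p+q∣ p q = trans (∣p-q∣≡∣q-p∣ p q)
  (cong ∣_∣ (solve 2 (λ p q → q :- p := (:- p) :- (:- q)) refl p q))

∣p-q∣<r⇒p<q+r : ∀ {p q r} → ∣ p ℚ.- q ∣ ℚ.< r → p ℚ.< q ℚ.+ r
∣p-q∣<r⇒p<q+r {p} {q} {r} p-q<r = begin-strict
  p                  ≡⟨ solve 2 (λ p q → p := q :+ (p :- q)) refl p q ⟩
  q ℚ.+ (p ℚ.- q)    <⟨ ℚₚ.+-monoʳ-< q (ℚₚ.≤-<-trans (p≤∣p∣ (p ℚ.- q)) p-q<r) ⟩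
  q ℚ.+ r            ∎
  where open ℚₚ.≤-Reasoning

p<q+r⇒p-q<r : ∀ {p q r} → p ℚ.< q ℚ.+ r → p ℚ.- q ℚ.< r
p<q+r⇒p-q<r {p} {q} {r} p<q+r = begin-strict
  p ℚ.- q            <⟨ ℚₚ.+-monoˡ-< (ℚ.- q) p<q+r ⟩
  q ℚ.+ r ℚ.- q      ≡⟨ solve 2 (λ q r → q :+ r :- q := r) refl q r ⟩
  r                  ∎
  where open ℚₚ.≤-Reasoning

p+q<r⇒q<r-p : ∀ {p q r} → p ℚ.+ q ℚ.< r → q ℚ.< r ℚ.- p
p+q<r⇒q<r-p {p} {q} {r} p+q<r = begin-strict
  q                  ≡⟨ solve 2 (λ p q → q := p :+ q :- p) refl p q ⟩
  p ℚ.+ q ℚ.- p      <⟨ ℚₚ.+-monoˡ-< (ℚ.- p) p+q<r ⟩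
  r ℚ.- p            ∎
  where open ℚₚ.≤-Reasoning

q<r-p⇒p+q<r : ∀ {p q r} → q ℚ.< r ℚ.- p → p ℚ.+ q ℚ.< r
q<r-p⇒p+q<r {p} {q} {r} q<r-p = begin-strict
  p ℚ.+ q            <⟨ ℚₚ.+-monoʳ-< p q<r-p ⟩
  p ℚ.+ (r ℚ.- p)    ≡⟨ solve 2 (λ p r → p :+ (r :- p) := r) refl p r ⟩
  r                  ∎
  where open ℚₚ.≤-Reasoning

0<-p+q⇒p<q : ∀ {p q} → 0ℚ ℚ.< ℚ.- p ℚ.+ q → p ℚ.< q
0<-p+q⇒p<q {p} {q} 0<-p+q = subst₂ ℚ._<_ (ℚₚ.+-identityʳ p)
  (solve 2 (λ p q → p :+ (:- p :+ q) := q) refl p q) (ℚₚ.+-monoʳ-< p 0<-p+q)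

∣p-q∣<r : ∀ {p q r} → p ℚ.< q ℚ.+ r → q ℚ.< p ℚ.+ r → ∣ p ℚ.- q ∣ ℚ.< r
∣p-q∣<r {p} {q} {r} p<q+r q<p+r with ℚₚ.≤-total 0ℚ (p ℚ.- q)
... | inj₁ 0≤p-q = subst (ℚ._< r) (sym (ℚₚ.0≤p⇒∣p∣≡p 0≤p-q)) (p<q+r⇒p-q<r p<q+r)
... | inj₂ p-q≤0 = subst (ℚ._< r) (sym ∣p-q∣≡q-p) (p<q+r⇒p-q<r q<p+r)
  where
  0≤q-p : 0ℚ ℚ.≤ q ℚ.- p
  0≤q-p = subst (0ℚ ℚ.≤_) (solve 2 (λ p q → :- (p :- q) := q :- p) refl p q)
    (ℚₚ.neg-antimono-≤ p-q≤0)
  ∣p-q∣≡q-p : ∣ p ℚ.- q ∣ ≡ q ℚ.- p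
  ∣p-q∣≡q-p = trans (∣p-q∣≡∣q-p∣ p q) (ℚₚ.0≤p⇒∣p∣≡p 0≤q-p)

p<p+q : ∀ p {q} → 0ℚ ℚ.< q → p ℚ.< p ℚ.+ q
p<p+q p {q} 0<q = subst (ℚ._< p ℚ.+ q) (ℚₚ.+-identityʳ p) (ℚₚ.+-monoʳ-< p 0<q)

+-half : ∀ p ε → p ℚ.+ ½ ℚ.* ε ℚ.+ ½ ℚ.* ε ≡ p ℚ.+ ε
+-half p ε = trans (ℚₚ.+-assoc p (½ ℚ.* ε) (½ ℚ.* ε)) (cong (p ℚ.+_) (½+½ ε))

-- Real numbers

-- The tail condition common to `_≃_`, `_≤_` and `_<_`; the two combinators below reduce their laws
-- to termwise rational inequalities.
Eventually : (ℕ → Set) → Set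
Eventually P = ∃[ N ] (∀ n → N ℕ.≤ n → P n)

eventually-map : ∀ {P Q : ℕ → Set} → (∀ n → P n → Q n) → Eventually P → Eventually Q
eventually-map f (N , p) = N , λ n N≤n → f n (p n N≤n)

eventually-zip : ∀ {P Q R : ℕ → Set} → (∀ n → P n → Q n → R n) →
                 Eventually P → Eventually Q → Eventually R
eventually-zip f (N , p) (M , q) = N ℕ.⊔ M , λ n N⊔M≤n →
  f n (p n (ℕₚ.m⊔n≤o⇒m≤o N M N⊔M≤n)) (q n (ℕₚ.m⊔n≤o⇒n≤o N M N⊔M≤n))

≗⇒≃ : ∀ {x y} → (∀ n → seq x n ≡ seq y n) → x ≃ y
≗⇒≃ {x} {y} x≗y ε 0<ε = 0 , λ n _ → subst (ℚ._< ε)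
  (sym (cong ∣_∣ (trans (cong (ℚ._- seq y n) (x≗y n)) (ℚₚ.+-inverseʳ (seq y n))))) 0<ε

≃-refl : ∀ {x} → x ≃ x
≃-refl {x} = ≗⇒≃ {x} {x} (λ _ → refl)

≃-sym : ∀ {x y} → x ≃ y → y ≃ x
≃-sym {x} {y} x≃y ε 0<ε = eventually-map
  (λ n → subst (ℚ._< ε) (∣p-q∣≡∣q-p∣ (seq x n) (seq y n))) (x≃y ε 0<ε)

≃⇒≤ : ∀ {x y} → x ≃ y → x ≤ y
≃⇒≤ x≃y ε 0<ε = eventually-map (λ n → ∣p-q∣<r⇒p<q+r) (x≃y ε 0<ε)

≤-antisym : ∀ {x y} → x ≤ y → y ≤ x → x ≃ y
≤-antisym x≤y y≤x ε 0<ε = eventually-zip (λ n → ∣p-q∣<r) (x≤y ε 0<ε) (y≤x ε 0<ε)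

≤-trans : ∀ {x y z} → x ≤ y → y ≤ z → x ≤ z
≤-trans {x} {y} {z} x≤y y≤z ε 0<ε = eventually-zip
  (λ n x<y y<z → let open ℚₚ.≤-Reasoning in begin-strict
    seq x n                              <⟨ x<y ⟩
    seq y n ℚ.+ ½ ℚ.* ε                  <⟨ ℚₚ.+-monoˡ-< (½ ℚ.* ε) y<z ⟩
    seq z n ℚ.+ ½ ℚ.* ε ℚ.+ ½ ℚ.* ε      ≡⟨ +-half (seq z n) ε ⟩
    seq z n ℚ.+ ε                        ∎)
  (x≤y (½ ℚ.* ε) (0<½* 0<ε)) (y≤z (½ ℚ.* ε) (0<½* 0<ε))

+-mono-≤ : ∀ {x y u v} → x ≤ y → u ≤ v → x + u ≤ y + v
+-mono-≤ {x} {y} {u} {v} x≤y u≤v ε 0<ε = eventually-zip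
  (λ n x<y u<v → let open ℚₚ.≤-Reasoning in begin-strict
    seq x n ℚ.+ seq u n                                    <⟨ ℚₚ.+-mono-< x<y u<v ⟩
    (seq y n ℚ.+ ½ ℚ.* ε) ℚ.+ (seq v n ℚ.+ ½ ℚ.* ε)        ≡⟨ regroup (seq y n) (seq v n) (½ ℚ.* ε) ⟩
    seq y n ℚ.+ seq v n ℚ.+ ½ ℚ.* ε ℚ.+ ½ ℚ.* ε            ≡⟨ +-half (seq y n ℚ.+ seq v n) ε ⟩
    seq y n ℚ.+ seq v n ℚ.+ ε                              ∎)
  (x≤y (½ ℚ.* ε) (0<½* 0<ε)) (u≤v (½ ℚ.* ε) (0<½* 0<ε))
  where
  regroup : ∀ a b h → (a ℚ.+ h) ℚ.+ (b ℚ.+ h) ≡ a ℚ.+ b ℚ.+ h ℚ.+ h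
  regroup = solve 3 (λ a b h → (a :+ h) :+ (b :+ h) := a :+ b :+ h :+ h) refl

-- Going through `_≤_` in both directions reuses the splitting of `ε` in `≤-trans`.
≃-trans : ∀ {x y z} → x ≃ y → y ≃ z → x ≃ z
≃-trans {x} {y} {z} x≃y y≃z = ≤-antisym {x} {z}
  (≤-trans {x} {y} {z} (≃⇒≤ {x} {y} x≃y) (≃⇒≤ {y} {z} y≃z))
  (≤-trans {z} {y} {x} (≃⇒≤ {z} {y} (≃-sym {y} {z} y≃z)) (≃⇒≤ {y} {x} (≃-sym {x} {y} x≃y)))

*-congˡ : ∀ {x y z} → y ≃ z → x * y ≃ x * z
*-congˡ {x} {y} {z} y≃z ε 0<ε =
  -- A Cauchy sequence is eventually bounded by some `B`, so closeness of `y` and `z` within `ε`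
  -- divided by `B` suffices.
  let B , 0<B , xbounded = bounded (cauchy x)
      δ , 0<δ , Bδ≡ε    = scale B ε 0<B 0<ε
  in eventually-zip
    (λ n x≤B y-z<δ → let open ℚₚ.≤-Reasoning in begin-strict
      ∣ seq x n ℚ.* seq y n ℚ.- seq x n ℚ.* seq z n ∣
        ≡⟨ cong ∣_∣ (factor (seq x n) (seq y n) (seq z n)) ⟩
      ∣ seq x n ℚ.* (seq y n ℚ.- seq z n) ∣
        <⟨ *-small {a = seq x n} {b = seq y n ℚ.- seq z n} 0<B x≤B y-z<δ ⟩
      B ℚ.* δ
        ≡⟨ Bδ≡ε ⟩
      ε ∎)
    xbounded (y≃z δ 0<δ)
  where
  factor : ∀ a b c → a ℚ.* b ℚ.- a ℚ.* c ≡ a ℚ.* (b ℚ.- c)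
  factor = solve 3 (λ a b c → a :* b :- a :* c := a :* (b :- c)) refl

1ℝ : ℝ
1ℝ = mkℝ (λ _ → 1ℚ) (const-cauchy 1ℚ)

-- _≃_, _≤_ and _<_ unfold to function types from which Agda cannot infer the
-- two reals, hence the record wrappers.

infix 4 _≈_ 0≤_ 0<_

record _≈_ (x y : ℝ) : Set where
  constructor wrap
  field unwrap : x ≃ y

record 0≤_ (x : ℝ) : Set where
  constructor wrap
  field unwrap : 0ℝ ≤ x

record 0<_ (x : ℝ) : Set where
  constructor wrap
  field unwrap : 0ℝ < x

≗⇒≈ : ∀ {x y} → (∀ n → seq x n ≡ seq y n) → x ≈ y
≗⇒≈ {x} {y} x≗y = wrap (≗⇒≃ {x} {y} x≗y)

≈-trans : ∀ {x y z} → x ≈ y → y ≈ z → x ≈ z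
≈-trans {x} {y} {z} (wrap x≃y) (wrap y≃z) = wrap (≃-trans {x} {y} {z} x≃y y≃z)

≈-isEquivalence : IsEquivalence _≈_
≈-isEquivalence = record
  { refl  = λ {x} → wrap (≃-refl {x})
  ; sym   = λ { {x} {y} (wrap x≃y) → wrap (≃-sym {x} {y} x≃y) }
  ; trans = ≈-trans
  }

-- ℝ and ℚ have η, so comparing two distinct expressions for the same real would
-- unfold rational arithmetic; abstract copies of the operations prevent that.

infixl 6 _⊕_
infixl 7 _⊗_
infix  8 -_

abstract

  _⊕_ _⊗_ : ℝ → ℝ → ℝ
  _⊕_ = _+_
  _⊗_ = _*_

  -_ : ℝ → ℝ
  - x = mkℝ (λ n → ℚ.- seq x n) λ ε 0<ε →
    let N , p = cauchy x ε 0<ε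
    in N , λ m n N≤m N≤n → subst (ℚ._< ε) (∣p-q∣≡∣-p+q∣ (seq x m) (seq x n)) (p m n N≤m N≤n)

  -- Provable by `refl` only while the abstract copies still unfold; outside the block these two
  -- equations are what relates the two sets of operations.
  +≡⊕ : ∀ x y → x + y ≡ x ⊕ y
  +≡⊕ x y = refl

  *≡⊗ : ∀ x y → x * y ≡ x ⊗ y
  *≡⊗ x y = refl

  +-cong : ∀ {x y u v} → x ≈ y → u ≈ v → x ⊕ u ≈ y ⊕ v
  +-cong {x} {y} {u} {v} (wrap x≃y) (wrap u≃v) = wrap (≤-antisym {x ⊕ u} {y ⊕ v}
    (+-mono-≤ {x} {y} {u} {v} (≃⇒≤ {x} {y} x≃y) (≃⇒≤ {u} {v} u≃v))
    (+-mono-≤ {y} {x} {v} {u} (≃⇒≤ {y} {x} (≃-sym {x} {y} x≃y)) (≃⇒≤ {v} {u} (≃-sym {u} {v} u≃v))))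

  *-comm : ∀ x y → x ⊗ y ≈ y ⊗ x
  *-comm x y = ≗⇒≈ λ n → ℚₚ.*-comm (seq x n) (seq y n)

  *-cong : ∀ {x y u v} → x ≈ y → u ≈ v → x ⊗ u ≈ y ⊗ v
  *-cong {x} {y} {u} {v} (wrap x≃y) (wrap u≃v) =
    ≈-trans {y = x ⊗ v} (wrap (*-congˡ {x} {u} {v} u≃v))
    (≈-trans (*-comm x v) (≈-trans (wrap (*-congˡ {v} {x} {y} x≃y)) (*-comm v y)))

  -‿cong : ∀ {x y} → x ≈ y → - x ≈ - y
  -‿cong {x} {y} (wrap x≃y) = wrap λ ε 0<ε → eventually-map
    (λ n → subst (ℚ._< ε) (∣p-q∣≡∣-p+q∣ (seq x n) (seq y n))) (x≃y ε 0<ε)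

  +-assoc : ∀ x y z → (x ⊕ y) ⊕ z ≈ x ⊕ (y ⊕ z)
  +-assoc x y z = ≗⇒≈ λ n → ℚₚ.+-assoc (seq x n) (seq y n) (seq z n)

  +-comm : ∀ x y → x ⊕ y ≈ y ⊕ x
  +-comm x y = ≗⇒≈ λ n → ℚₚ.+-comm (seq x n) (seq y n)

  +-identityˡ : ∀ x → 0ℝ ⊕ x ≈ x
  +-identityˡ x = ≗⇒≈ λ n → ℚₚ.+-identityˡ (seq x n)

  +-inverseˡ : ∀ x → - x ⊕ x ≈ 0ℝ
  +-inverseˡ x = ≗⇒≈ λ n → ℚₚ.+-inverseˡ (seq x n)

  *-assoc : ∀ x y z → (x ⊗ y) ⊗ z ≈ x ⊗ (y ⊗ z)
  *-assoc x y z = ≗⇒≈ λ n → ℚₚ.*-assoc (seq x n) (seq y n) (seq z n)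

  *-identityˡ : ∀ x → 1ℝ ⊗ x ≈ x
  *-identityˡ x = ≗⇒≈ λ n → ℚₚ.*-identityˡ (seq x n)

  *-distribˡ-+ : ∀ x y z → x ⊗ (y ⊕ z) ≈ x ⊗ y ⊕ x ⊗ z
  *-distribˡ-+ x y z = ≗⇒≈ λ n → ℚₚ.*-distribˡ-+ (seq x n) (seq y n) (seq z n)

  +-identityʳ : ∀ x → x ⊕ 0ℝ ≈ x
  +-identityʳ x = ≗⇒≈ λ n → ℚₚ.+-identityʳ (seq x n)

  +-inverseʳ : ∀ x → x ⊕ - x ≈ 0ℝ
  +-inverseʳ x = ≗⇒≈ λ n → ℚₚ.+-inverseʳ (seq x n)

  *-identityʳ : ∀ x → x ⊗ 1ℝ ≈ x
  *-identityʳ x = ≗⇒≈ λ n → ℚₚ.*-identityʳ (seq x n)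

  *-distribʳ-+ : ∀ x y z → (y ⊕ z) ⊗ x ≈ y ⊗ x ⊕ z ⊗ x
  *-distribʳ-+ x y z = ≗⇒≈ λ n → ℚₚ.*-distribʳ-+ (seq x n) (seq y n) (seq z n)

  -- This lemma and the next three translate between the binary order relations and the sign
  -- predicates of the abstract argument.
  ≤⇒0≤ : ∀ {x y} → x ≤ y → 0≤ y ⊕ - x
  ≤⇒0≤ {x} {y} x≤y = wrap (≤-trans {0ℝ} {x ⊕ - x} {y ⊕ - x}
    (≃⇒≤ {0ℝ} {x ⊕ - x} (≃-sym {x ⊕ - x} {0ℝ} (_≈_.unwrap (+-inverseʳ x))))
    (+-mono-≤ {x} {y} { - x} { - x} x≤y (≃⇒≤ { - x} { - x} (≃-refl { - x}))))

  0≤⇒≤ : ∀ {x y} → 0≤ y ⊕ - x → x ≤ y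
  0≤⇒≤ {x} {y} (wrap 0≤y-x) ε 0<ε = eventually-map
    (λ n 0<y-x+ε → let open ℚₚ.≤-Reasoning in begin-strict
      seq x n                                      ≡⟨ ℚₚ.+-identityʳ (seq x n) ⟨
      seq x n ℚ.+ 0ℚ                               <⟨ ℚₚ.+-monoʳ-< (seq x n) 0<y-x+ε ⟩
      seq x n ℚ.+ (seq y n ℚ.- seq x n ℚ.+ ε)      ≡⟨ regroup (seq x n) (seq y n) ε ⟩
      seq y n ℚ.+ ε                                ∎)
    (0≤y-x ε 0<ε)
    where
    regroup : ∀ a b e → a ℚ.+ (b ℚ.- a ℚ.+ e) ≡ b ℚ.+ e
    regroup = solve 3 (λ a b e → a :+ (b :- a :+ e) := b :+ e) refl

  -- The rational gap is kept; only the subtracted term changes sides. The converse below keeps it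
  -- as well.
  <⇒0< : ∀ {x y} → x < y → 0< y ⊕ - x
  <⇒0< (ε , 0<ε , x+ε<y) = wrap (ε , 0<ε , eventually-map
    (λ n p → subst (ℚ._< _) (sym (ℚₚ.+-identityˡ ε)) (p+q<r⇒q<r-p p)) x+ε<y)

  0<⇒< : ∀ {x y} → 0< y ⊕ - x → x < y
  0<⇒< (wrap (ε , 0<ε , 0+ε<y-x)) = ε , 0<ε , eventually-map
    (λ n p → q<r-p⇒p+q<r (subst (ℚ._< _) (ℚₚ.+-identityˡ ε) p)) 0+ε<y-x

  0≤-resp-≈ : ∀ {x y} → x ≈ y → 0≤ x → 0≤ y
  0≤-resp-≈ {x} {y} (wrap x≃y) (wrap 0≤x) = wrap (≤-trans {0ℝ} {x} {y} 0≤x (≃⇒≤ {x} {y} x≃y))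

  0≤-0 : 0≤ 0ℝ
  0≤-0 = wrap (≃⇒≤ {0ℝ} {0ℝ} (≃-refl {0ℝ}))

  0≤-+ : ∀ {x y} → 0≤ x → 0≤ y → 0≤ x ⊕ y
  0≤-+ {x} {y} (wrap 0≤x) (wrap 0≤y) = wrap (+-mono-≤ {0ℝ} {x} {0ℝ} {y} 0≤x 0≤y)

  0<⇒0≤ : ∀ {x} → 0< x → 0≤ x
  0<⇒0≤ {x} (wrap (δ , 0<δ , 0+δ<x)) = wrap λ ε 0<ε → eventually-map
    (λ n 0+δ<x → ℚₚ.<-trans 0<δ (ℚₚ.<-trans
      (subst (ℚ._< seq x n) (ℚₚ.+-identityˡ δ) 0+δ<x) (p<p+q (seq x n) 0<ε)))
    0+δ<x

  0≤-antisym : ∀ {x} → 0≤ x → 0≤ - x → x ≈ 0ℝ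
  0≤-antisym {x} (wrap 0≤x) (wrap 0≤-x) = wrap (≤-antisym {x} {0ℝ} x≤0 0≤x)
    where
    x≤0 : x ≤ 0ℝ
    x≤0 ε 0<ε = eventually-map
      (λ n 0<-x+ε → subst (seq x n ℚ.<_) (sym (ℚₚ.+-identityˡ ε)) (0<-p+q⇒p<q 0<-x+ε))
      (0≤-x ε 0<ε)

  0<⇒0≰- : ∀ {x} → 0< x → ¬ 0≤ - x
  0<⇒0≰- {x} (wrap (ε , 0<ε , 0+ε<x)) (wrap 0≤-x) =
    -- The gap of `0< x` serves as tolerance in `0≤ - x`, so late terms lie both above and below
    -- `ε`. This eventual absurdity is evaluated at its own threshold.
    let N , p = eventually-zip {R = λ _ → ⊥} absurd 0+ε<x (0≤-x ε 0<ε)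
    in p N ℕₚ.≤-refl
    where
    absurd : ∀ n → 0ℚ ℚ.+ ε ℚ.< seq x n → 0ℚ ℚ.< ℚ.- seq x n ℚ.+ ε → ⊥
    absurd n 0+ε<x 0<-x+ε = ℚₚ.<-asym
      (subst (ℚ._< seq x n) (ℚₚ.+-identityˡ ε) 0+ε<x) (0<-p+q⇒p<q 0<-x+ε)

  -- If a late term lies below ε/2 then all later terms lie below ε; otherwise all
  -- later terms exceed a fixed positive rational.
  0≮⇒0≤- : ∀ {x} → ¬ 0< x → 0≤ - x
  -- Oscillation below a quarter of `ε` serves both cases: added to one half it stays below `ε`, and
  -- subtracted from one half it leaves a quarter as the gap.
  0≮⇒0≤- {x} 0≮x = wrap λ ε 0<ε → go ε 0<ε (cauchy x (½ ℚ.* (½ ℚ.* ε)) (0<½* (0<½* 0<ε)))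
    where
    go : ∀ ε → 0ℚ ℚ.< ε →
         ∃[ N ] (∀ m n → N ℕ.≤ m → N ℕ.≤ n → ∣ seq x m ℚ.- seq x n ∣ ℚ.< ½ ℚ.* (½ ℚ.* ε)) →
         Eventually (λ n → 0ℚ ℚ.< ℚ.- seq x n ℚ.+ ε)
    go ε 0<ε (N , close) with seq x N ℚₚ.<? ½ ℚ.* ε
    ... | yes x<½ε = N , λ n N≤n → subst (0ℚ ℚ.<_) (ℚₚ.+-comm ε (ℚ.- seq x n))
      (p+q<r⇒q<r-p (subst (ℚ._< ε) (sym (ℚₚ.+-identityʳ (seq x n))) (below n N≤n)))
      where
      open ℚₚ.≤-Reasoning
      below : ∀ n → N ℕ.≤ n → seq x n ℚ.< ε
      below n N≤n = begin-strict
        seq x n                          <⟨ ∣p-q∣<r⇒p<q+r (close n N N≤n ℕₚ.≤-refl) ⟩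
        seq x N ℚ.+ ½ ℚ.* (½ ℚ.* ε)      <⟨ ℚₚ.+-mono-< x<½ε (p<p+q (½ ℚ.* (½ ℚ.* ε)) (0<½* (0<½* 0<ε))) ⟩
        ½ ℚ.* ε ℚ.+ (½ ℚ.* (½ ℚ.* ε) ℚ.+ ½ ℚ.* (½ ℚ.* ε))
                                         ≡⟨ cong (½ ℚ.* ε ℚ.+_) (½+½ (½ ℚ.* ε)) ⟩
        ½ ℚ.* ε ℚ.+ ½ ℚ.* ε              ≡⟨ ½+½ ε ⟩
        ε                                ∎
    ... | no x≮½ε = contradiction
      (wrap (½ ℚ.* (½ ℚ.* ε) , 0<½* (0<½* 0<ε) , N , above)) 0≮x
      where
      open ℚₚ.≤-Reasoning
      above : ∀ n → N ℕ.≤ n → 0ℚ ℚ.+ ½ ℚ.* (½ ℚ.* ε) ℚ.< seq x n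
      above n N≤n = begin-strict
        0ℚ ℚ.+ ½ ℚ.* (½ ℚ.* ε)                        ≡⟨ ℚₚ.+-identityˡ _ ⟩
        ½ ℚ.* (½ ℚ.* ε)                               ≡⟨ solve 1 (λ h → h := h :+ h :- h) refl (½ ℚ.* (½ ℚ.* ε)) ⟩
        ½ ℚ.* (½ ℚ.* ε) ℚ.+ ½ ℚ.* (½ ℚ.* ε) ℚ.- ½ ℚ.* (½ ℚ.* ε)
                                                      ≡⟨ cong (ℚ._- ½ ℚ.* (½ ℚ.* ε)) (½+½ (½ ℚ.* ε)) ⟩
        ½ ℚ.* ε ℚ.- ½ ℚ.* (½ ℚ.* ε)                   ≤⟨ ℚₚ.+-monoˡ-≤ _ (ℚₚ.≮⇒≥ x≮½ε) ⟩
        seq x N ℚ.- ½ ℚ.* (½ ℚ.* ε)                   <⟨ p<q+r⇒p-q<r (subst (seq x N ℚ.<_) (ℚₚ.+-comm (seq x n) _)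
                                                           (∣p-q∣<r⇒p<q+r (close N n ℕₚ.≤-refl N≤n))) ⟩
        seq x n                                       ∎

  0<-* : ∀ {x y} → 0< x → 0< y → 0< x ⊗ y
  0<-* {x} {y} (wrap (ε , 0<ε , 0+ε<x)) (wrap (δ , 0<δ , 0+δ<y)) =
    -- The product of the two gaps is a gap for the product.
    wrap (ε ℚ.* δ , 0<εδ , eventually-zip εδ<xy 0+ε<x 0+δ<y)
    where
    open ℚₚ.≤-Reasoning
    instance
      ε⁺ : ℚ.Positive ε
      ε⁺ = ℚ.positive 0<ε
    0<εδ : 0ℚ ℚ.< ε ℚ.* δ
    0<εδ = subst (ℚ._< ε ℚ.* δ) (ℚₚ.*-zeroʳ ε) (ℚₚ.*-monoʳ-<-pos ε 0<δ)
    εδ<xy : ∀ n → 0ℚ ℚ.+ ε ℚ.< seq x n → 0ℚ ℚ.+ δ ℚ.< seq y n →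
            0ℚ ℚ.+ ε ℚ.* δ ℚ.< seq x n ℚ.* seq y n
    εδ<xy n 0+ε<x 0+δ<y = begin-strict
      0ℚ ℚ.+ ε ℚ.* δ           ≡⟨ ℚₚ.+-identityˡ _ ⟩
      ε ℚ.* δ                  <⟨ ℚₚ.*-monoʳ-<-pos ε δ<y ⟩
      ε ℚ.* seq y n            <⟨ ℚₚ.*-monoˡ-<-pos (seq y n) {{ℚ.positive (ℚₚ.<-trans 0<δ δ<y)}} ε<x ⟩
      seq x n ℚ.* seq y n      ∎
      where
      ε<x : ε ℚ.< seq x n
      ε<x = subst (ℚ._< seq x n) (ℚₚ.+-identityˡ ε) 0+ε<x
      δ<y : δ ℚ.< seq y n
      δ<y = subst (ℚ._< seq y n) (ℚₚ.+-identityˡ δ) 0+δ<y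

-- The real numbers as an ordered commutative ring

+-isSemigroup : IsSemigroup _≈_ _⊕_
+-isSemigroup = record
  { isMagma = record { isEquivalence = ≈-isEquivalence ; ∙-cong = +-cong } ; assoc = +-assoc }

+-isMonoid : IsMonoid _≈_ _⊕_ 0ℝ
+-isMonoid = record { isSemigroup = +-isSemigroup ; identity = +-identityˡ , +-identityʳ }

+-isAbelianGroup : IsAbelianGroup _≈_ _⊕_ 0ℝ (-_)
+-isAbelianGroup = record
  { isGroup = record
    { isMonoid = +-isMonoid ; inverse = +-inverseˡ , +-inverseʳ ; ⁻¹-cong = -‿cong }
  ; comm = +-comm
  }

+-*-isRing : IsRing _≈_ _⊕_ _⊗_ (-_) 0ℝ 1ℝ
+-*-isRing = record
  { +-isAbelianGroup = +-isAbelianGroup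
  ; *-cong           = *-cong
  ; *-assoc          = *-assoc
  ; *-identity       = *-identityˡ , *-identityʳ
  ; distrib          = *-distribˡ-+ , *-distribʳ-+
  }

+-*-commutativeRing : CommutativeRing 0ℓ 0ℓ
+-*-commutativeRing = record
  { isCommutativeRing = record { isRing = +-*-isRing ; *-comm = *-comm } }

+-*-orderedCommutativeRing : OrderedCommutativeRing
+-*-orderedCommutativeRing = record
  { commutativeRing = +-*-commutativeRing
  ; 0≤_        = 0≤_
  ; 0<_        = 0<_
  ; 0≤-resp-≈  = 0≤-resp-≈
  ; 0≤-0#      = 0≤-0
  ; 0≤-+       = 0≤-+
  ; 0≤-antisym = 0≤-antisym
  ; 0<⇒0≤      = 0<⇒0≤
  ; 0<⇒0≰-     = 0<⇒0≰-
  ; 0≮⇒0≤-     = 0≮⇒0≤-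
  ; 0<-*       = 0<-*
  }

-- Transfer of the comparison to the concrete operations

open OrderedRingProperties +-*-orderedCommutativeRing using (sum)

-- Both kinds of sum are folds whose operations agree only pointwise and propositionally. Concluding
-- with `_≡_` lets whole hypotheses be transported by `subst`.
foldr-cong : ∀ {A B : Set} {_∙_ _◦_ : A → B → B} {ε n} {f g : Vector A n} →
             (∀ x y → x ∙ y ≡ x ◦ y) → (∀ i → f i ≡ g i) → foldr _∙_ ε f ≡ foldr _◦_ ε g
foldr-cong {n = ℕ.zero} ∙≡◦ f≗g = refl
foldr-cong {_∙_ = _∙_} {n = suc n} ∙≡◦ f≗g =
  trans (cong₂ _∙_ (f≗g zero) (foldr-cong ∙≡◦ (f≗g ∘ suc))) (∙≡◦ _ _)

∑≡sum : ∀ {n} {f g : Vector ℝ n} → (∀ i → f i ≡ g i) → ∑ f ≡ sum g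
∑≡sum = foldr-cong {_∙_ = _+_} {_◦_ = _⊕_} {ε = 0ℝ} +≡⊕

∑*≡sum⊗ : ∀ {n} (f g : Vector ℝ n) → ∑ (λ i → f i * g i) ≡ sum (λ i → f i ⊗ g i)
∑*≡sum⊗ f g = ∑≡sum (λ i → *≡⊗ (f i) (g i))

rowSum≡sum : ∀ {n} (C : Matrix n) i → rowSum C i ≡ sum (C i)
rowSum≡sum C i = ∑≡sum {f = C i} (λ _ → refl)

open EigenvalueComparison +-*-orderedCommutativeRing

theorem4p3 : ∀ (m : ℕ) (C C' : Matrix (suc m)) (v v' : Vector ℝ (suc m)) (μ μ' : ℝ) →
    (∀ i (j : Fin m) → C i (inject₁ j) ≤ C' i (inject₁ j)) →
    (∀ i → rowSum C i ≤ rowSum C' i) →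
    Rooted v' → IsEigenvector C' μ' v' →
    NonNegative v → IsLeftEigenvector C μ v →
    0ℝ < v ∙ v' →
    (μ ≤ μ') ×
    (μ ≃ μ' ⇔
    ((¬ (last v' ≃ 0ℝ) → ∀ i → ¬ (v i ≃ 0ℝ) → rowSum C i ≃ rowSum C' i) ×
    (∀ i (j : Fin m) → ¬ (v i ≃ 0ℝ) → last v' < v' (inject₁ j) →
    C' i (inject₁ j) ≃ C i (inject₁ j))))
theorem4p3 m C C' v v' μ μ' C≤C' r≤r' (ℓ≤v' , 0≤ℓ) (_ , C'v'≃μ'v') 0≤v (_ , vC≃μv) 0<v∙v' =
  0≤⇒≤ {μ} {μ'} (proj₁ comparison) , mk⇔
  (λ μ≃μ' → let r≈r' , C'≈C = to (proj₂ comparison) (wrap μ≃μ') in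
    (λ ℓ≄0 i v≄0 → _≈_.unwrap (subst₂ _≈_ (sym (rowSum≡sum C i)) (sym (rowSum≡sum C' i))
      (r≈r' (ℓ≄0 ∘ _≈_.unwrap) i (v≄0 ∘ _≈_.unwrap)))) ,
    (λ i j v≄0 ℓ<v' → _≈_.unwrap (C'≈C i j (v≄0 ∘ _≈_.unwrap)
      (<⇒0< {last v'} {v' (inject₁ j)} ℓ<v'))))
  (λ (r≃r' , C'≃C) → _≈_.unwrap (from (proj₂ comparison)
    ( (λ ℓ≉0 i v≉0 → subst₂ _≈_ (rowSum≡sum C i) (rowSum≡sum C' i)
        (wrap (r≃r' (ℓ≉0 ∘ wrap) i (v≉0 ∘ wrap))))
    , (λ i j v≉0 0<d → wrap (C'≃C i j (v≉0 ∘ wrap) (0<⇒< {last v'} {v' (inject₁ j)} 0<d))))))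
  where
  comparison = eigenvalue-comparison C C' v v' μ μ'
    -- Each hypothesis is wrapped and then carried over to the abstract sums and products.
    (λ i → subst₂ _≈_ (∑*≡sum⊗ (C' i) v') (*≡⊗ μ' (v' i)) (wrap (C'v'≃μ'v' i)))
    (λ j → subst₂ _≈_ (∑*≡sum⊗ v (λ i → C i j)) (*≡⊗ μ (v j)) (wrap (vC≃μv j)))
    (λ i j → ≤⇒0≤ {C i (inject₁ j)} {C' i (inject₁ j)} (C≤C' i j))
    (λ i → subst₂ (λ r r' → 0≤ r' ⊕ - r) (rowSum≡sum C i) (rowSum≡sum C' i)
      (≤⇒0≤ {rowSum C i} {rowSum C' i} (r≤r' i)))
    (λ j → ≤⇒0≤ {last v'} {v' (inject₁ j)} (ℓ≤v' j))
    (wrap 0≤ℓ) (λ i → wrap (0≤v i))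
    (subst 0<_ (∑*≡sum⊗ v v') (wrap 0<v∙v'))
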